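{- Let $n \geq 3$ be an integer. Then for every $j \in [2^n]$, $$w_n\big(G_n, \boldsymbol{\pi}^{(n;\,j)}\big) = j ,$$ where $G_n$ is the majority graph and $\boldsymbol{\pi}^{(n;\,j)}$ are the brackets defined in the context, and $w_n$ is the winner map of the knockout tournament.
   Context: For a positive integer $m$, $[m]=\{1,\dots,m\}$. $\Pi(n)$ is the set of permutations of $[2^n]$, each written as a list $\boldsymbol{\pi}=(\boldsymbol{\pi}(1),\dots,\boldsymbol{\pi}(2^n))$; a permutation used as the initial order of candidates is called a bracket. $\mathcal{H}(n)$ is the set of complete directed graphs (tournaments) with vertex set $[2^n]$: no loops, and for any two distinct vertices $a,b$ exactly one of $(a,b)$, $(b,a)$ is an arrow. The arrow $(a,b)$ means that $a$ beats $b$. Knockout tournament and $w_n$: given $G\in\mathcal{H}(n)$ and $\boldsymbol{\pi}\in\Pi(n)$, in the first round the candidates in positions $2t-1$ and $2t$ of $\boldsymbol{\pi}$ are matched for $t=1,\dots,2^{n-1}$; the winner of a match between $a$ and $b$ is $a$ if $(a,b)$ is an arrow of $G$ and $b$ otherwise. The winners, kept in the same relative order, form a list of length $2^{n-1}$, to which the same procedure is applied, and so on for $n$ rounds. $w_n(G,\boldsymbol{\pi})\in[2^n]$ is the single remaining candidate (the winner). Graph $G_3=([8],E_3)$: $E_3$ consists of the 28 arrows $(1,2),(1,3),(1,5),(2,3),(2,4),(2,6),(2,7),$ $(3,4),(3,5),(3,6),(3,8),(4,1),(4,5),(4,8),$ $(5,2),(5,6),(5,7),(6,1),(6,4),(6,7),(6,8),$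 $(7,1),(7,3),(7,4),(7,8),(8,1),(8,2),(8,5).$ Classes: for $q\in[2^{n-3}]$ let $C_q=[8q]\setminus[8(q-1)]$; these partition $[2^n]$. Write $i\sim j$ if $i,j$ lie in the same class. Graph $G_n=([2^n],E_n)$ for $n\ge 4$: for $i,j$ in the same class $C_q$, $(i,j)\in E_n$ if and only if $(i-8(q-1),\,j-8(q-1))\in E_3$. For $i<j$ in different classes, $(i,j)\in E_n$ if $i+j$ is even, and $(j,i)\in E_n$ if $i+j$ is odd. Base permutations of $[8]$: $\boldsymbol{\pi}^{(1)}=(1,2,3,4,5,6,7,8)$, $\boldsymbol{\pi}^{(2)}=(2,3,4,1,6,7,8,5)$, $\boldsymbol{\pi}^{(3)}=(3,6,4,1,8,2,5,7)$, $\boldsymbol{\pi}^{(4)}=(4,1,8,2,5,6,7,3)$, $\boldsymbol{\pi}^{(5)}=(5,6,7,8,2,3,4,1)$, $\boldsymbol{\pi}^{(6)}=(6,7,8,5,1,2,3,4)$, $\boldsymbol{\pi}^{(7)}=(7,8,1,2,3,5,6,4)$, $\boldsymbol{\pi}^{(8)}=(8,1,5,6,2,3,7,4)$. Brackets: for $k\in[2^n]$ let $b_k=\lceil k/8\rceil-1$ (so $k\in C_{b_k+1}$). For $j\in[2^n]$ and $k\in[2^n]$: - if $k\sim j$: $\boldsymbol{\pi}^{(n;\,j)}(k)=\boldsymbol{\pi}^{(j-8b_k)}(k-8b_k)+8b_k$; - if $k\not\sim j$ and $k<j$: $\boldsymbol{\pi}^{(n;\,j)}(k)=\boldsymbol{\pi}^{(1)}(k-8b_k)+8b_k$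 when $j$ is even, and $\boldsymbol{\pi}^{(2)}(k-8b_k)+8b_k$ when $j$ is odd; - if $k\not\sim j$ and $k>j$: $\boldsymbol{\pi}^{(n;\,j)}(k)=\boldsymbol{\pi}^{(2)}(k-8b_k)+8b_k$ when $j$ is even, and $\boldsymbol{\pi}^{(1)}(k-8b_k)+8b_k$ when $j$ is odd. For $n=3$ this gives $\boldsymbol{\pi}^{(3;\,j)}=\boldsymbol{\pi}^{(j)}$. -}

module Defs where

open import Data.Bool.Base using (if_then_else_)
open import Data.Fin.Base using (Fin; toℕ; fromℕ<; cast; combine)
open import Data.Fin.Patterns
open import Data.Fin.Permutation using (Permutation′; permutation; _⟨$⟩ʳ_; _⟨$⟩ˡ_; inverseˡ; inverseʳ)
open import Data.Fin.Properties as Fin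
  using (toℕ-injective; toℕ-fromℕ<; toℕ<n; all?; any?)
open import Data.List.Base using (List; []; _∷_)
import Data.List.Membership.DecPropositional as DecMembership
open import Data.Nat.Base
  using (ℕ; zero; suc; _+_; _*_; _∸_; _^_; _≤_; _<_; s≤s; s≤s⁻¹; parity)
open import Data.Nat.DivMod using (_/_; _%_; _mod_; m≡m%n+[m/n]*n; m*n/n≡m; m<n*o⇒m/o<n; /-monoˡ-≤)
open import Data.Nat.Properties
open import Data.Parity.Base using (0ℙ; 1ℙ)
open import Data.Product.Base using (_×_; _,_; proj₁; proj₂; ∃)
import Data.Product.Properties as Product
open import Data.Sum.Base using (_⊎_; inj₁; inj₂)
open import Data.Vec.Base using (Vec; []; _∷_; lookup)
open import Data.Vec.Functional using (Vector)
open import Function.Base using (_∘_)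
open import Level using (0ℓ)
open import Relation.Binary.Consequences using (tri⇒dec<)
open import Relation.Binary.Core using (Rel)
open import Relation.Binary.Definitions using (Decidable; Trichotomous; tri<; tri≈; tri>)
open import Relation.Binary.PropositionalEquality
open import Relation.Nullary using (¬_; yes; no; does; contradiction)
open import Relation.Nullary.Decidable using (from-yes; ¬?; _⊎-dec_; _→-dec_; map′)

-- Trichotomy says precisely that there are no loops and that any two distinct
-- vertices are joined by exactly one arrow.
record Tournament (m : ℕ) : Set₁ where
  field
    _⟶_     : Rel (Fin m) 0ℓ
    compare : Trichotomous _≡_ _⟶_

  _⟶?_ : Decidable _⟶_
  _⟶?_ = tri⇒dec< compare

  winner : Fin m → Fin m → Fin m
  winner a b = if does (a ⟶? b) then a else b

ℋ : ℕ → Set₁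
ℋ n = Tournament (2 ^ n)

Π : ℕ → Set
Π n = Permutation′ (2 ^ n)

-- toℕ (position t s) = 2 * toℕ t + toℕ s: the pair of positions 2t-1 and 2t
-- when positions and t are counted from 1.
position : ∀ {m} → Fin m → Fin 2 → Fin (2 * m)
position {m} t s = cast (*-comm m 2) (combine t s)

playRound : ∀ {A : Set} {m} → (A → A → A) → Vector A (2 * m) → Vector A m
playRound match xs t = match (xs (position t 0F)) (xs (position t 1F))

knockout : ∀ {A : Set} n → (A → A → A) → Vector A (2 ^ n) → A
knockout zero    match xs = xs 0F
knockout (suc n) match xs = knockout n match (playRound match xs)

w : ∀ n → ℋ n → Π n → Fin (2 ^ n)
w n G π = knockout n (Tournament.winner G) (π ⟨$⟩ʳ_)

-- The element of [m] represented by an element of Fin m.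
label : ∀ {m} → Fin m → ℕ
label k = suc (toℕ k)

pattern ① = 0F
pattern ② = 1F
pattern ③ = 2F
pattern ④ = 3F
pattern ⑤ = 4F
pattern ⑥ = 5F
pattern ⑦ = 6F
pattern ⑧ = 7F

E₃ : List (Fin 8 × Fin 8)
E₃ = (① , ②) ∷ (① , ③) ∷ (① , ⑤) ∷ (② , ③) ∷ (② , ④) ∷ (② , ⑥) ∷ (② , ⑦)
   ∷ (③ , ④) ∷ (③ , ⑤) ∷ (③ , ⑥) ∷ (③ , ⑧) ∷ (④ , ①) ∷ (④ , ⑤) ∷ (④ , ⑧)
   ∷ (⑤ , ②) ∷ (⑤ , ⑥) ∷ (⑤ , ⑦) ∷ (⑥ , ①) ∷ (⑥ , ④) ∷ (⑥ , ⑦) ∷ (⑥ , ⑧)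
   ∷ (⑦ , ①) ∷ (⑦ , ③) ∷ (⑦ , ④) ∷ (⑦ , ⑧) ∷ (⑧ , ①) ∷ (⑧ , ②) ∷ (⑧ , ⑤)
   ∷ []

open DecMembership (Product.≡-dec (Fin._≟_ {8}) (Fin._≟_ {8})) using (_∈_; _∈?_)

E₃-irrefl : ∀ a → ¬ (a , a) ∈ E₃
E₃-irrefl = from-yes (all? λ a → ¬? ((a , a) ∈? E₃))

E₃-asym : ∀ a b → (a , b) ∈ E₃ → ¬ (b , a) ∈ E₃
E₃-asym = from-yes (all? λ a → all? λ b → ((a , b) ∈? E₃) →-dec ¬? ((b , a) ∈? E₃))

E₃-total : ∀ a b → a ≡ b ⊎ ((a , b) ∈ E₃ ⊎ (b , a) ∈ E₃)
E₃-total = from-yes (all? λ a → all? λ b →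
  (a Fin.≟ b) ⊎-dec (((a , b) ∈? E₃) ⊎-dec ((b , a) ∈? E₃)))

-- C q = [8q] \ [8(q-1)]. For q = 0 this is empty, and if it meets [2^n] with
-- n ≥ 3 then q ≤ 2^(n-3), so q need not be bounded explicitly below.
C : ℕ → ℕ → Set
C q k = 8 * (q ∸ 1) < k × k ≤ 8 * q

infix 4 _∼_ _∼?_

record _∼_ {m} (i j : Fin m) : Set where
  constructor both∈
  field
    class : ℕ
    i∈C   : C class (label i)
    j∈C   : C class (label j)

-- b k = ⌈ label k / 8 ⌉ - 1, because label k = suc (toℕ k).
b : ∀ {m} → Fin m → ℕ
b k = toℕ k / 8

-- label (offset k) = label k - 8 * b k
offset : ∀ {m} → Fin m → Fin 8
offset k = toℕ k mod 8

label-offset : ∀ {m} (k : Fin m) → label k ≡ label (offset k) + 8 * b k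
label-offset k = cong suc (begin
  toℕ k                          ≡⟨ m≡m%n+[m/n]*n (toℕ k) 8 ⟩
  toℕ k % 8 + toℕ k / 8 * 8      ≡⟨ cong₂ _+_ (sym (toℕ-fromℕ< _)) (*-comm (toℕ k / 8) 8) ⟩
  toℕ (offset k) + 8 * b k       ∎)
  where open ≡-Reasoning

C-b : ∀ {m} (k : Fin m) → C (suc (b k)) (label k)
C-b k rewrite label-offset k =
    s≤s (m≤n+m (8 * b k) (toℕ (offset k)))
  , subst (label (offset k) + 8 * b k ≤_) (sym (*-suc 8 (b k)))
      (+-monoˡ-≤ (8 * b k) (toℕ<n (offset k)))

/-unique : ∀ x c → 8 * c ≤ x → x < 8 * suc c → x / 8 ≡ c
/-unique x c lo hi = ≤-antisym
  (s≤s⁻¹ (m<n*o⇒m/o<n (subst (x <_) (*-comm 8 (suc c)) hi)))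
  (subst (_≤ x / 8) (trans (cong (_/ 8) (*-comm 8 c)) (m*n/n≡m c 8)) (/-monoˡ-≤ 8 lo))

C⇒b : ∀ {m} q (k : Fin m) → C q (label k) → suc (b k) ≡ q
C⇒b (suc c) k (lo , hi) = cong suc (/-unique (toℕ k) c (s≤s⁻¹ lo) hi)

∼⇒≡ : ∀ {m} {i j : Fin m} → i ∼ j → b i ≡ b j
∼⇒≡ {i = i} {j} (both∈ q ci cj) = suc-injective (trans (C⇒b q i ci) (sym (C⇒b q j cj)))

≡⇒∼ : ∀ {m} {i j : Fin m} → b i ≡ b j → i ∼ j
≡⇒∼ {i = i} {j} eq = both∈ (suc (b i)) (C-b i) (subst (λ c → C (suc c) (label j)) (sym eq) (C-b j))

_∼?_ : ∀ {m} → Decidable (_∼_ {m})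
i ∼? j = map′ ≡⇒∼ ∼⇒≡ (b i ≟ b j)

∼-sym : ∀ {m} {i j : Fin m} → i ∼ j → j ∼ i
∼-sym (both∈ q ci cj) = both∈ q cj ci

data Arrow {m : ℕ} (i j : Fin m) : Set where
  inside   : i ∼ j → (offset i , offset j) ∈ E₃ → Arrow i j
  forward  : ¬ i ∼ j → label i < label j → parity (label i + label j) ≡ 0ℙ → Arrow i j
  backward : ¬ i ∼ j → label j < label i → parity (label j + label i) ≡ 1ℙ → Arrow i j

∼∧offset⇒≡ : ∀ {m} {i j : Fin m} → i ∼ j → offset i ≡ offset j → i ≡ j
∼∧offset⇒≡ {i = i} {j} i∼j eq = toℕ-injective (suc-injective (begin
  label i                      ≡⟨ label-offset i ⟩
  label (offset i) + 8 * b i   ≡⟨ cong₂ (λ r c → label r + 8 * c) eq (∼⇒≡ i∼j) ⟩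
  label (offset j) + 8 * b j   ≡⟨ label-offset j ⟨
  label j                      ∎))
  where open ≡-Reasoning

Arrow-irrefl : ∀ {m} {i j : Fin m} → i ≡ j → ¬ Arrow i j
Arrow-irrefl {i = i} refl (inside _ e)     = E₃-irrefl (offset i) e
Arrow-irrefl         refl (forward n _ _)  = n (≡⇒∼ refl)
Arrow-irrefl         refl (backward n _ _) = n (≡⇒∼ refl)

0ℙ≢1ℙ : 0ℙ ≢ 1ℙ
0ℙ≢1ℙ ()

Arrow-asym : ∀ {m} {i j : Fin m} → Arrow i j → ¬ Arrow j i
Arrow-asym {i = i} {j} (inside _ e) (inside _ e′) = E₃-asym (offset i) (offset j) e e′
Arrow-asym (inside s _)       (forward n _ _)     = n (∼-sym s)
Arrow-asym (inside s _)       (backward n _ _)    = n (∼-sym s)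
Arrow-asym (forward n _ _)    (inside s _)        = n (∼-sym s)
Arrow-asym (backward n _ _)   (inside s _)        = n (∼-sym s)
Arrow-asym (forward _ lt _)   (forward _ gt _)    = <-asym lt gt
Arrow-asym (forward _ _ even) (backward _ _ odd)  = 0ℙ≢1ℙ (trans (sym even) odd)
Arrow-asym (backward _ _ odd) (forward _ _ even)  = 0ℙ≢1ℙ (trans (sym even) odd)
Arrow-asym (backward _ lt _)  (backward _ gt _)   = <-asym lt gt

inside-total : ∀ {m} {i j : Fin m} → i ∼ j →
  offset i ≡ offset j ⊎ ((offset i , offset j) ∈ E₃ ⊎ (offset j , offset i) ∈ E₃) →
  i ≡ j ⊎ (Arrow i j ⊎ Arrow j i)
inside-total s (inj₁ eq)       = inj₁ (∼∧offset⇒≡ s eq)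
inside-total s (inj₂ (inj₁ e)) = inj₂ (inj₁ (inside s e))
inside-total s (inj₂ (inj₂ e)) = inj₂ (inj₂ (inside (∼-sym s) e))

-- Not `with E₃-total …`, which would normalise that decision procedure on open terms.
Arrow-total : ∀ {m} (i j : Fin m) → i ≡ j ⊎ (Arrow i j ⊎ Arrow j i)
Arrow-total i j with i ∼? j
... | yes s = inside-total s (E₃-total (offset i) (offset j))
Arrow-total i j | no n with <-cmp (label i) (label j)
... | tri≈ _ eq _ = inj₁ (toℕ-injective (suc-injective eq))
... | tri< lt _ _ with parity (label i + label j) in eq
...   | 0ℙ = inj₂ (inj₁ (forward n lt eq))
...   | 1ℙ = inj₂ (inj₂ (backward (n ∘ ∼-sym) lt eq))
Arrow-total i j | no n | tri> _ _ gt with parity (label j + label i) in eq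
...   | 0ℙ = inj₂ (inj₂ (forward (n ∘ ∼-sym) gt eq))
...   | 1ℙ = inj₂ (inj₁ (backward n gt eq))

Arrow-cmp : ∀ {m} → Trichotomous _≡_ (Arrow {m})
Arrow-cmp i j with Arrow-total i j
... | inj₁ eq       = tri≈ (Arrow-irrefl eq) eq (Arrow-irrefl (sym eq))
... | inj₂ (inj₁ a) = tri< a (λ eq → Arrow-irrefl eq a) (Arrow-asym a)
... | inj₂ (inj₂ a) = tri> (Arrow-asym a) (λ eq → Arrow-irrefl (sym eq) a) a

-- The intended range is n ≥ 3. For n = 3 there is a single class and the arrows
-- are those of E₃ (see G₃-forth and G₃-back).
G : ∀ n → ℋ n
G n = record { _⟶_ = Arrow ; compare = Arrow-cmp }

offset₈ : ∀ (i : Fin 8) → offset i ≡ i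
offset₈ = from-yes (all? λ i → offset i Fin.≟ i)

∼₈ : ∀ (i j : Fin 8) → i ∼ j
∼₈ = from-yes (all? λ (i : Fin 8) → all? λ j → i ∼? j)

G₃-forth : ∀ i j → Tournament._⟶_ (G 3) i j → (i , j) ∈ E₃
G₃-forth i j (inside _ e) = subst₂ (λ a c → (a , c) ∈ E₃) (offset₈ i) (offset₈ j) e
G₃-forth i j (forward n _ _)  = contradiction (∼₈ i j) n
G₃-forth i j (backward n _ _) = contradiction (∼₈ i j) n

G₃-back : ∀ i j → (i , j) ∈ E₃ → Tournament._⟶_ (G 3) i j
G₃-back i j e = inside (∼₈ i j)
  (subst₂ (λ a c → (a , c) ∈ E₃) (sym (offset₈ i)) (sym (offset₈ j)) e)

baseTable : Vec (Vec (Fin 8) 8) 8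
baseTable
  = (① ∷ ② ∷ ③ ∷ ④ ∷ ⑤ ∷ ⑥ ∷ ⑦ ∷ ⑧ ∷ [])
  ∷ (② ∷ ③ ∷ ④ ∷ ① ∷ ⑥ ∷ ⑦ ∷ ⑧ ∷ ⑤ ∷ [])
  ∷ (③ ∷ ⑥ ∷ ④ ∷ ① ∷ ⑧ ∷ ② ∷ ⑤ ∷ ⑦ ∷ [])
  ∷ (④ ∷ ① ∷ ⑧ ∷ ② ∷ ⑤ ∷ ⑥ ∷ ⑦ ∷ ③ ∷ [])
  ∷ (⑤ ∷ ⑥ ∷ ⑦ ∷ ⑧ ∷ ② ∷ ③ ∷ ④ ∷ ① ∷ [])
  ∷ (⑥ ∷ ⑦ ∷ ⑧ ∷ ⑤ ∷ ① ∷ ② ∷ ③ ∷ ④ ∷ [])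
  ∷ (⑦ ∷ ⑧ ∷ ① ∷ ② ∷ ③ ∷ ⑤ ∷ ⑥ ∷ ④ ∷ [])
  ∷ (⑧ ∷ ① ∷ ⑤ ∷ ⑥ ∷ ② ∷ ③ ∷ ⑦ ∷ ④ ∷ [])
  ∷ []

baseImage : Fin 8 → Fin 8 → Fin 8
baseImage a = lookup (lookup baseTable a)

abstract
  base-surjective : ∀ a y → ∃ λ x → baseImage a x ≡ y
  base-surjective = from-yes (all? λ a → all? λ y → any? λ x → baseImage a x Fin.≟ y)

  base-injective : ∀ a x y → baseImage a x ≡ baseImage a y → x ≡ y
  base-injective = from-yes (all? λ a → all? λ x → all? λ y →
    (baseImage a x Fin.≟ baseImage a y) →-dec (x Fin.≟ y))

base : Fin 8 → Permutation′ 8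
base a = permutation (baseImage a) (proj₁ ∘ base-surjective a)
  (proj₂ ∘ base-surjective a)
  (λ x → base-injective a _ x (proj₂ (base-surjective a (baseImage a x))))

-- The index of the base permutation that π^(n;j) uses at position k. Outside the
-- class of j, k ≢ j, so ¬ (label k < label j) means label j < label k.
selector : ∀ {m} → Fin m → Fin m → Fin 8
selector j k with k ∼? j | label k <? label j | parity (label j)
... | yes _ | _     | _  = offset j
... | no _  | yes _ | 0ℙ = ①
... | no _  | yes _ | 1ℙ = ②
... | no _  | no _  | 0ℙ = ②
... | no _  | no _  | 1ℙ = ①

<-respˡ-∼ : ∀ {m} {j k k′ : Fin m} → k ∼ k′ → ¬ k ∼ j → label k < label j → label k′ < label j
<-respˡ-∼ {j = j} {k} {k′} s n lt with label k′ <? label j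
... | yes lt′ = lt′
... | no ≮ = contradiction (≡⇒∼ (≤-antisym
  (/-monoˡ-≤ 8 (<⇒≤ (s≤s⁻¹ lt)))
  (subst (b j ≤_) (sym (∼⇒≡ s)) (/-monoˡ-≤ 8 (s≤s⁻¹ (≮⇒≥ ≮)))))) n

selector-cong : ∀ {m} (j : Fin m) {k k′} → k ∼ k′ → selector j k ≡ selector j k′
selector-cong j {k} {k′} s
  with k ∼? j | label k <? label j | k′ ∼? j | label k′ <? label j | parity (label j)
... | yes _ | _      | yes _ | _       | _  = refl
... | yes c | _      | no n  | _       | _  = contradiction (≡⇒∼ (trans (sym (∼⇒≡ s)) (∼⇒≡ c))) n
... | no n  | _      | yes c | _       | _  = contradiction (≡⇒∼ (trans (∼⇒≡ s) (∼⇒≡ c))) n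
... | no n  | yes lt | no _  | no ≮    | _  = contradiction (<-respˡ-∼ s n lt) ≮
... | no _  | no ≮   | no n  | yes lt  | _  = contradiction (<-respˡ-∼ (∼-sym s) n lt) ≮
... | no _  | yes _  | no _  | yes _   | 0ℙ = refl
... | no _  | yes _  | no _  | yes _   | 1ℙ = refl
... | no _  | no _   | no _  | no _    | 0ℙ = refl
... | no _  | no _   | no _  | no _    | 1ℙ = refl

shift-bound : ∀ {n} → 3 ≤ n → (k : Fin (2 ^ n)) (r : Fin 8) → toℕ r + 8 * b k < 2 ^ n
shift-bound {n} n≥3 k r = begin-strict
  toℕ r + 8 * b k   <⟨ +-monoˡ-< (8 * b k) (toℕ<n r) ⟩
  8 + 8 * b k       ≡⟨ *-suc 8 (b k) ⟨
  8 * suc (b k)     ≤⟨ *-monoʳ-≤ 8 (m<n*o⇒m/o<n {n = c} (subst (toℕ k <_) eq (toℕ<n k))) ⟩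
  8 * c             ≡⟨ *-comm 8 c ⟩
  c * 8             ≡⟨ eq ⟨
  2 ^ n             ∎
  where
  open ≤-Reasoning
  c = 2 ^ (n ∸ 3)
  eq : 2 ^ n ≡ c * 8
  eq = trans (cong (2 ^_) (sym (m∸n+n≡m n≥3))) (^-distribˡ-+-* 2 (n ∸ 3) 3)

shift : ∀ {n} → 3 ≤ n → Fin (2 ^ n) → Fin 8 → Fin (2 ^ n)
shift n≥3 k r = fromℕ< (shift-bound n≥3 k r)

module _ {n} (n≥3 : 3 ≤ n) where

  label-shift : ∀ k r → label (shift n≥3 k r) ≡ label r + 8 * b k
  label-shift k r = cong suc (toℕ-fromℕ< (shift-bound n≥3 k r))

  b-shift : ∀ k r → b (shift n≥3 k r) ≡ b k
  b-shift k r = /-unique _ (b k)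
    (subst (8 * b k ≤_) (sym (suc-injective (label-shift k r))) (m≤n+m _ (toℕ r)))
    (subst₂ _<_ (sym (suc-injective (label-shift k r))) (sym (*-suc 8 (b k)))
      (+-monoˡ-< (8 * b k) (toℕ<n r)))

  offset-shift : ∀ k r → offset (shift n≥3 k r) ≡ r
  offset-shift k r = toℕ-injective (suc-injective (+-cancelʳ-≡ (8 * b k) _ _ (begin
    label (offset s) + 8 * b k   ≡⟨ cong (λ c → label (offset s) + 8 * c) (b-shift k r) ⟨
    label (offset s) + 8 * b s   ≡⟨ label-offset s ⟨
    label s                      ≡⟨ label-shift k r ⟩
    label r + 8 * b k            ∎)))
    where
    open ≡-Reasoning
    s = shift n≥3 k r

  shift-∼ : ∀ k r → shift n≥3 k r ∼ k
  shift-∼ k r = ≡⇒∼ (b-shift k r)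

  act : (Fin 8 → Fin 8 → Fin 8) → Fin (2 ^ n) → Fin (2 ^ n) → Fin (2 ^ n)
  act f j k = shift n≥3 k (f (selector j k) (offset k))

  act-inverse : ∀ f g → (∀ a r → f a (g a r) ≡ r) → ∀ j k → act f j (act g j k) ≡ k
  act-inverse f g fg j k = ∼∧offset⇒≡
    (≡⇒∼ (trans (b-shift l (f (selector j l) (offset l))) (b-shift k (g a (offset k)))))
    (begin
      offset (act f j l)                   ≡⟨ offset-shift l (f (selector j l) (offset l)) ⟩
      f (selector j l) (offset l)          ≡⟨ cong₂ f (selector-cong j (shift-∼ k (g a (offset k))))
                                                      (offset-shift k (g a (offset k))) ⟩
      f a (g a (offset k))                 ≡⟨ fg a (offset k) ⟩
      offset k                             ∎)
    where
    open ≡-Reasoning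
    a = selector j k
    l = act g j k

  bracket : Fin (2 ^ n) → Π n
  bracket j = permutation (act to j) (act from j)
    (act-inverse to from (λ a r → inverseʳ (base a) {r}) j)
    (act-inverse from to (λ a r → inverseˡ (base a) {r}) j)
    where
    to from : Fin 8 → Fin 8 → Fin 8
    to   a = base a ⟨$⟩ʳ_
    from a = base a ⟨$⟩ˡ_

  label-bracket : ∀ j k →
    label (bracket j ⟨$⟩ʳ k) ≡ label (base (selector j k) ⟨$⟩ʳ offset k) + 8 * b k
  label-bracket j k = label-shift k (base (selector j k) ⟨$⟩ʳ offset k)

{-# OPTIONS --safe #-}

-- The first three rounds take place inside the classes C q, and inside a class
-- G n is a copy of G 3. The class of j is therefore won by j, and any other class
-- by the label 1 or 2 of its base permutation, shifted by a multiple of 8. That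
-- label is odd below j and even above j when j is even, and the other way round
-- when j is odd, so j beats all other survivors and wins the remaining rounds.
module Submission where

open import Defs
open import Data.Nat.Base using (ℕ; _≤_; _^_)
open import Data.Fin.Base using (Fin)
open import Relation.Binary.PropositionalEquality using (_≡_)

open import Data.Fin.Base using (toℕ; fromℕ<; cast; combine; quotient; remainder)
open import Data.Fin.Patterns
open import Data.Fin.Permutation using (_⟨$⟩ʳ_)
open import Data.Fin.Properties as Fin
  using (toℕ-injective; toℕ-fromℕ<; toℕ<n; toℕ-cast; toℕ-combine; combine-surjective; all?)
open import Data.Nat.Base using (suc; zero; _+_; _*_; _<_; parity)
open import Data.Nat.DivMod using (m<n*o⇒m/o<n)
open import Data.Nat.Properties
open import Data.Nat.Tactic.RingSolver using (solve-∀)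
open import Data.Parity.Base as ℙ using (0ℙ; 1ℙ)
import Data.Parity.Properties as ℙ
open import Data.Product.Base using (_,_; ∃; ∃₂)
open import Data.Sum.Base using (_⊎_; inj₁; inj₂)
open import Data.Vec.Functional using (Vector)
open import Function.Base using (_∘_)
open import Relation.Binary.Definitions using (tri<; tri≈; tri>)
open import Relation.Binary.PropositionalEquality
  using (refl; sym; trans; cong; cong₂; subst; module ≡-Reasoning)
open import Relation.Nullary using (¬_; yes; no; contradiction)
open import Relation.Nullary.Decidable using (from-yes)

-- Pairings and knockouts in general.

toℕ-position : ∀ {m} (t : Fin m) s → toℕ (position t s) ≡ 2 * toℕ t + toℕ s
toℕ-position {m} t s = trans (toℕ-cast (*-comm m 2) (combine t s)) (toℕ-combine t s)

position-surjective : ∀ {m} (k : Fin (2 * m)) → ∃₂ λ t s → position t s ≡ k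
position-surjective {m} k with combine-surjective {m} {2} (cast (*-comm 2 m) k)
... | t , s , eq = t , s , toℕ-injective (begin
  toℕ (position t s)             ≡⟨ toℕ-cast (*-comm m 2) (combine t s) ⟩
  toℕ (combine t s)              ≡⟨ cong toℕ eq ⟩
  toℕ (cast (*-comm 2 m) k)      ≡⟨ toℕ-cast (*-comm 2 m) k ⟩
  toℕ k                          ∎)
  where open ≡-Reasoning

-- `knockout` is uniform in the type of candidates, so a relation respected by single matches
-- survives every round. This carries winners in `G 3` over to the classes of `G n`.
knockout-preserves : ∀ {A B : Set} {f : A → A → A} {g : B → B → B} (R : A → B → Set) →
  (∀ {x x′ y y′} → R x y → R x′ y′ → R (f x x′) (g y y′)) →
  ∀ n {xs : Vector A (2 ^ n)} {ys : Vector B (2 ^ n)} →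
  (∀ k → R (xs k) (ys k)) → R (knockout n f xs) (knockout n g ys)
knockout-preserves R R-match zero    xsRys = xsRys 0F
knockout-preserves R R-match (suc n) xsRys = knockout-preserves R R-match n
  (λ t → R-match (xsRys (position t 0F)) (xsRys (position t 1F)))

module _ {m} (T : Tournament m) where
  open Tournament T

  winner-⟶ : ∀ {x y} → x ⟶ y → winner x y ≡ x
  winner-⟶ {x} {y} x⟶y with compare x y
  ... | tri< _ _ _    = refl
  ... | tri≈ x⟶̸y _ _ = contradiction x⟶y x⟶̸y
  ... | tri> x⟶̸y _ _ = contradiction x⟶y x⟶̸y

  winner-⟵ : ∀ {x y} → y ⟶ x → winner x y ≡ y
  winner-⟵ {x} {y} y⟶x with compare x y
  ... | tri< _ _ y⟶̸x = contradiction y⟶x y⟶̸x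
  ... | tri≈ _ _ _    = refl
  ... | tri> _ _ _    = refl

  -- Needed because `Dominates` is reflexive and `knockout-dominant` admits vectors with repeated
  -- entries.
  winner-idem : ∀ x → winner x x ≡ x
  winner-idem x with compare x x
  ... | tri< _ _ _ = refl
  ... | tri≈ _ _ _ = refl
  ... | tri> _ _ _ = refl

  winner-sel : ∀ x y → winner x y ≡ x ⊎ winner x y ≡ y
  winner-sel x y with compare x y
  ... | tri< _ _ _ = inj₁ refl
  ... | tri≈ _ _ _ = inj₂ refl
  ... | tri> _ _ _ = inj₂ refl

  Dominates : Fin m → Fin m → Set
  Dominates j x = j ≡ x ⊎ j ⟶ x

  winnerˡ : ∀ {j x} → Dominates j x → winner j x ≡ j
  winnerˡ (inj₁ refl) = winner-idem _
  winnerˡ (inj₂ j⟶x) = winner-⟶ j⟶x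

  winnerʳ : ∀ {j x} → Dominates j x → winner x j ≡ j
  winnerʳ (inj₁ refl) = winner-idem _
  winnerʳ (inj₂ j⟶x) = winner-⟵ j⟶x

  winner-dominated : ∀ {j x y} → Dominates j x → Dominates j y → Dominates j (winner x y)
  winner-dominated {j} {x} {y} dx dy with winner-sel x y
  ... | inj₁ eq = subst (Dominates j) (sym eq) dx
  ... | inj₂ eq = subst (Dominates j) (sym eq) dy

  -- Both hypotheses are invariants of a round: each match is won by one of its two entrants, and a
  -- match containing `j` is won by `j`.
  knockout-dominant : ∀ n {xs : Vector (Fin m) (2 ^ n)} {j} →
    (∀ t → Dominates j (xs t)) → (∃ λ t → xs t ≡ j) → knockout n winner xs ≡ j
  knockout-dominant zero    dom (0F , eq) = eq
  knockout-dominant (suc n) {xs} {j} dom (k , eq) = knockout-dominant n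
    (λ t → winner-dominated (dom (position t 0F)) (dom (position t 1F)))
    (survives (position-surjective {2 ^ n} k))
    where
    survives : (∃₂ λ (t : Fin (2 ^ n)) s → position t s ≡ k) → ∃ λ t → playRound winner xs t ≡ j
    survives (t , 0F , refl) =
      t , trans (cong (λ x → winner x (xs (position t 1F))) eq) (winnerˡ (dom (position t 1F)))
    survives (t , 1F , refl) =
      t , trans (cong (winner (xs (position t 0F))) eq) (winnerʳ (dom (position t 0F)))

-- Splitting off the first three rounds.

-- The r-th of the eight initial positions whose candidates meet in the first three
-- rounds for place t, nested so that three rounds unfold to a knockout over r.
leaf : ∀ {m} → Fin m → Fin 8 → Fin (2 * (2 * (2 * m)))
leaf t r = position (position (position t (quotient {2} 4 r))
                              (quotient {2} 2 (remainder {2} 4 r)))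
                    (remainder {2} 2 (remainder {2} 4 r))

-- Stated for an arbitrary tournament T because comparing terms over G n makes the
-- type checker unfold the decision procedure behind its matches.
w-three-rounds : ∀ m (T : ℋ (3 + m)) (T₃ : ℋ 3) (ρ : Fin 8 → Π 3) →
  (∀ a → w 3 T₃ (ρ a) ≡ a) →
  (R : Fin (2 ^ m) → Fin (2 ^ (3 + m)) → Fin 8 → Set) →
  (∀ t {x x′ y y′} → R t x y → R t x′ y′ →
    R t (Tournament.winner T x x′) (Tournament.winner T₃ y y′)) →
  (π : Π (3 + m)) (a : Fin (2 ^ m) → Fin 8) {j : Fin (2 ^ (3 + m))} →
  (∀ t r → R t (π ⟨$⟩ʳ leaf t r) (ρ (a t) ⟨$⟩ʳ r)) →
  (∀ {t x} → R t x (a t) → Dominates T j x) →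
  (∃ λ t → ∀ {x} → R t x (a t) → x ≡ j) →
  w (3 + m) T π ≡ j
w-three-rounds m T T₃ ρ ρ-winner R R-winner π a {j} leaves dominated (t , unique) =
  -- By unfolding alone, `w (3 + m) T π` is the knockout of `survivors`: at literal `r` the digits
  -- in `leaf t r` compute.
  knockout-dominant T m {survivors} (λ t → dominated (survivor t)) (t , unique (survivor t))
  where
  survivors : Vector (Fin (2 ^ (3 + m))) (2 ^ m)
  survivors t = knockout 3 (Tournament.winner T) (λ r → π ⟨$⟩ʳ leaf t r)
  survivor : ∀ t → R t (survivors t) (a t)
  survivor t = subst (R t (survivors t)) (ρ-winner (a t))
    (knockout-preserves (R t) (R-winner t) 3 (leaves t))

-- Binary expansion of `r`, most significant digit first; the outermost `position` in `leaf` carries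
-- the last digit.
toℕ-bits : ∀ (r : Fin 8) →
  4 * toℕ (quotient {2} 4 r) + 2 * toℕ (quotient {2} 2 (remainder {2} 4 r))
    + toℕ (remainder {2} 2 (remainder {2} 4 r)) ≡ toℕ r
toℕ-bits = from-yes (all? λ (r : Fin 8) →
  4 * toℕ (quotient {2} 4 r) + 2 * toℕ (quotient {2} 2 (remainder {2} 4 r))
    + toℕ (remainder {2} 2 (remainder {2} 4 r)) ≟ toℕ r)

toℕ-leaf : ∀ {m} (t : Fin m) r → toℕ (leaf t r) ≡ toℕ r + 8 * toℕ t
toℕ-leaf t r = begin
  toℕ (leaf t r)
    ≡⟨ toℕ-position (position (position t u) v) z ⟩
  2 * toℕ (position (position t u) v) + toℕ z
    ≡⟨ cong (λ x → 2 * x + toℕ z) (toℕ-position (position t u) v) ⟩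
  2 * (2 * toℕ (position t u) + toℕ v) + toℕ z
    ≡⟨ cong (λ x → 2 * (2 * x + toℕ v) + toℕ z) (toℕ-position t u) ⟩
  2 * (2 * (2 * toℕ t + toℕ u) + toℕ v) + toℕ z
    ≡⟨ expand (toℕ t) (toℕ u) (toℕ v) (toℕ z) ⟩
  4 * toℕ u + 2 * toℕ v + toℕ z + 8 * toℕ t
    ≡⟨ cong (_+ 8 * toℕ t) (toℕ-bits r) ⟩
  toℕ r + 8 * toℕ t
    ∎
  where
  open ≡-Reasoning
  u v z : Fin 2
  u = quotient {2} 4 r
  v = quotient {2} 2 (remainder {2} 4 r)
  z = remainder {2} 2 (remainder {2} 4 r)
  expand : ∀ t u v z → 2 * (2 * (2 * t + u) + v) + z ≡ 4 * u + 2 * v + z + 8 * t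
  expand = solve-∀

b-leaf : ∀ {m} (t : Fin m) r → b (leaf t r) ≡ toℕ t
b-leaf t r = /-unique _ (toℕ t)
  (subst (8 * toℕ t ≤_) (sym (toℕ-leaf t r)) (m≤n+m _ (toℕ r)))
  (subst (toℕ (leaf t r) <_) (sym (*-suc 8 (toℕ t)))
    (subst (_< 8 + 8 * toℕ t) (sym (toℕ-leaf t r)) (+-monoˡ-< (8 * toℕ t) (toℕ<n r))))

offset-leaf : ∀ {m} (t : Fin m) r → offset (leaf t r) ≡ r
offset-leaf t r = toℕ-injective (suc-injective (+-cancelʳ-≡ (8 * toℕ t) _ _ (begin
  label (offset k) + 8 * toℕ t   ≡⟨ cong (λ c → label (offset k) + 8 * c) (b-leaf t r) ⟨
  label (offset k) + 8 * b k     ≡⟨ label-offset k ⟨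
  label k                        ≡⟨ cong suc (toℕ-leaf t r) ⟩
  label r + 8 * toℕ t            ∎)))
  where
  open ≡-Reasoning
  k = leaf t r

-- Matches inside a class.

abstract
  -- A finite check: the eight base brackets are played out in `G 3`.
  base-winner : ∀ a → w 3 (G 3) (base a) ≡ a
  base-winner = from-yes (all? λ a → w 3 (G 3) (base a) Fin.≟ a)

Arrow⇒offset : ∀ {m} {i j : Fin m} → i ∼ j → Arrow i j → Arrow (offset i) (offset j)
Arrow⇒offset i∼j (inside _ e)       = G₃-back _ _ e
Arrow⇒offset i∼j (forward i≁j _ _)  = contradiction i∼j i≁j
Arrow⇒offset i∼j (backward i≁j _ _) = contradiction i∼j i≁j

-- Within a class every arrow is an `inside` arrow, which `E₃` determines through the offsets alone.
offset-winner : ∀ n {i j : Fin (2 ^ n)} → i ∼ j →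
  offset (Tournament.winner (G n) i j) ≡ Tournament.winner (G 3) (offset i) (offset j)
offset-winner n {i} {j} i∼j = by-cases (Arrow-total i j)
  where
  by-cases : i ≡ j ⊎ (Arrow i j ⊎ Arrow j i) →
    offset (Tournament.winner (G n) i j) ≡ Tournament.winner (G 3) (offset i) (offset j)
  by-cases (inj₁ refl) = trans (cong offset (winner-idem (G n) i)) (sym (winner-idem (G 3) (offset i)))
  by-cases (inj₂ (inj₁ i⟶j)) = trans (cong offset (winner-⟶ (G n) i⟶j))
    (sym (winner-⟶ (G 3) (Arrow⇒offset i∼j i⟶j)))
  by-cases (inj₂ (inj₂ j⟶i)) = trans (cong offset (winner-⟵ (G n) j⟶i))
    (sym (winner-⟵ (G 3) (Arrow⇒offset (∼-sym i∼j) j⟶i)))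

b-winner : ∀ n {i j : Fin (2 ^ n)} {c} → b i ≡ c → b j ≡ c → b (Tournament.winner (G n) i j) ≡ c
b-winner n {i} {j} bi bj with winner-sel (G n) i j
... | inj₁ eq = trans (cong b eq) bi
... | inj₂ eq = trans (cong b eq) bj

-- Parity and arrows between classes.

parity-label : ∀ {m} (k : Fin m) → parity (label k) ≡ parity (label (offset k))
parity-label k = begin
  parity (label k)
    ≡⟨ cong parity (label-offset k) ⟩
  parity (label (offset k) + 8 * b k)
    ≡⟨ ℙ.+-homo-+ (label (offset k)) (8 * b k) ⟩
  parity (label (offset k)) ℙ.+ parity (8 * b k)
    -- `parity 8` is `0ℙ`, which absorbs the other factor.
    ≡⟨ cong (parity (label (offset k)) ℙ.+_) (ℙ.*-homo-* 8 (b k)) ⟩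
  parity (label (offset k)) ℙ.+ 0ℙ
    ≡⟨ ℙ.+-identityʳ _ ⟩
  parity (label (offset k))
    ∎
  where open ≡-Reasoning

selector-inside : ∀ {m} {j k : Fin m} → k ∼ j → selector j k ≡ offset j
selector-inside {j = j} {k} k∼j with k ∼? j | label k <? label j | parity (label j)
... | yes _  | _ | _ = refl
... | no k≁j | _ | _ = contradiction k∼j k≁j

parity-label-+ : ∀ {m} (x : Fin m) l {r p} → offset x ≡ r → parity l ≡ p →
  parity (label x + l) ≡ parity (label r) ℙ.+ p
parity-label-+ x l refl refl =
  trans (ℙ.+-homo-+ (label x) l) (cong (ℙ._+ parity l) (parity-label x))

parity-+-label : ∀ {m} (x : Fin m) l {r p} → offset x ≡ r → parity l ≡ p →
  parity (l + label x) ≡ parity (label r) ℙ.+ p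
parity-+-label x l eq pl = trans (cong parity (+-comm l (label x))) (parity-label-+ x l eq pl)

≁-left : ∀ {m} {j k x : Fin m} → x ∼ k → ¬ k ∼ j → ¬ j ∼ x
≁-left x∼k k≁j j∼x = k≁j (≡⇒∼ (sym (trans (∼⇒≡ j∼x) (∼⇒≡ x∼k))))

-- Classes are intervals, so a `j` outside the class of `k` lies on the same side of all its
-- members.
>-respˡ-∼ : ∀ {m} {j k x : Fin m} → x ∼ k → ¬ k ∼ j → ¬ label k < label j → label j < label x
>-respˡ-∼ {j = j} {k} {x} x∼k k≁j k≮j = ≤∧≢⇒< (≮⇒≥ (k≮j ∘ <-respˡ-∼ x∼k (j≁x ∘ ∼-sym)))
  λ j≡x → j≁x (≡⇒∼ (cong b (toℕ-injective (suc-injective j≡x))))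
  where
  j≁x : ¬ j ∼ x
  j≁x = ≁-left x∼k k≁j

-- Splitting on the scrutinees of `selector` turns `eq` into a literal offset outside the class of
-- `j`. The parity sum then evaluates to odd below `j` and even above, so the arrow leaves `j`.
selector-dominated : ∀ n {j k x : Fin (2 ^ n)} → x ∼ k → offset x ≡ selector j k →
  Dominates (G n) j x
selector-dominated n {j} {k} {x} x∼k eq
  with k ∼? j | label k <? label j | parity (label j) in j-parity
... | yes k∼j | _ | _ = inj₁ (sym (∼∧offset⇒≡ (≡⇒∼ (trans (∼⇒≡ x∼k) (∼⇒≡ k∼j))) eq))
... | no k≁j | yes k<j | 0ℙ = inj₂ (backward (≁-left x∼k k≁j) (<-respˡ-∼ (∼-sym x∼k) k≁j k<j)
                                   (parity-label-+ x (label j) eq j-parity))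
... | no k≁j | yes k<j | 1ℙ = inj₂ (backward (≁-left x∼k k≁j) (<-respˡ-∼ (∼-sym x∼k) k≁j k<j)
                                   (parity-label-+ x (label j) eq j-parity))
... | no k≁j | no k≮j  | 0ℙ = inj₂ (forward (≁-left x∼k k≁j) (>-respˡ-∼ x∼k k≁j k≮j)
                                   (parity-+-label x (label j) eq j-parity))
... | no k≁j | no k≮j  | 1ℙ = inj₂ (forward (≁-left x∼k k≁j) (>-respˡ-∼ x∼k k≁j k≮j)
                                   (parity-+-label x (label j) eq j-parity))

-- Classes as copies of base brackets, and the winner.

-- `x` is the copy of `r` in class `C (suc c)`; the two coordinates determine `x`.
record Represents {m} (c : ℕ) (x : Fin m) (r : Fin 8) : Set where
  constructor represents
  field
    b≡c      : b x ≡ c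
    offset≡r : offset x ≡ r

winner-represents : ∀ n {c} {x x′ : Fin (2 ^ n)} {r r′} →
  Represents c x r → Represents c x′ r′ →
  Represents c (Tournament.winner (G n) x x′) (Tournament.winner (G 3) r r′)
winner-represents n {x = x} {x′} (represents bx refl) (represents bx′ refl) =
  represents (b-winner n {x} {x′} bx bx′) (offset-winner n {x} {x′} (≡⇒∼ (trans bx (sym bx′))))

represented-winner : ∀ m (π : Π (3 + m)) (a : Fin (2 ^ m) → Fin 8) {j} →
  (∀ t r → Represents (toℕ t) (π ⟨$⟩ʳ leaf t r) (baseImage (a t) r)) →
  (∀ {t x} → Represents (toℕ t) x (a t) → Dominates (G (3 + m)) j x) →
  (∃ λ t → ∀ {x} → Represents (toℕ t) x (a t) → x ≡ j) →
  w (3 + m) (G (3 + m)) π ≡ j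
represented-winner m = w-three-rounds m (G (3 + m)) (G 3) base base-winner
  (λ t → Represents (toℕ t)) (λ t → winner-represents (3 + m))

module _ {m} (n≥3 : 3 ≤ 3 + m) (j : Fin (2 ^ (3 + m))) where

  -- The eight leaves of `t` form one class, on which `selector j` is constant, so leaf `0F` can
  -- stand for all of them.
  leafSelector : Fin (2 ^ m) → Fin 8
  leafSelector t = selector j (leaf t 0F)

  bracket-represents : ∀ (t : Fin (2 ^ m)) r →
    Represents (toℕ t) (bracket n≥3 j ⟨$⟩ʳ leaf t r) (baseImage (leafSelector t) r)
  bracket-represents t r = represents
    (trans (b-shift n≥3 k image) (b-leaf t r))
    (trans (offset-shift n≥3 k image)
      (cong₂ baseImage
        (selector-cong j {k} {leaf t 0F} (≡⇒∼ (trans (b-leaf t r) (sym (b-leaf t 0F)))))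
        (offset-leaf t r)))
    where
    k = leaf t r
    image = baseImage (selector j k) (offset k)

  represented-dominated : ∀ {t x} → Represents (toℕ t) x (leafSelector t) → Dominates (G (3 + m)) j x
  represented-dominated {t} (represents bx ox) =
    selector-dominated (3 + m) {k = leaf t 0F} (≡⇒∼ (trans bx (sym (b-leaf t 0F)))) ox

  represented-by-j : ∃ λ t → ∀ {x} → Represents (toℕ t) x (leafSelector t) → x ≡ j
  -- The class of `j` is at place `b j`. There the selector is `offset j`, so `x` shares both
  -- coordinates with `j`.
  represented-by-j = t , λ (represents bx ox) → ∼∧offset⇒≡ (≡⇒∼ (trans bx t≡bj))
    (trans ox (selector-inside {k = leaf t 0F} (≡⇒∼ (trans (b-leaf t 0F) t≡bj))))
    where
    bj<2^m : b j < 2 ^ m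
    bj<2^m = m<n*o⇒m/o<n
      (subst (toℕ j <_) (trans (^-distribˡ-+-* 2 3 m) (*-comm 8 (2 ^ m))) (toℕ<n j))
    t = fromℕ< bj<2^m
    t≡bj : toℕ t ≡ b j
    t≡bj = toℕ-fromℕ< bj<2^m

-- The equation instead of a match on n keeps the index in the literal form 3 + m of
-- represented-winner, so that G (3 + m) need not be unfolded.
bracket-winner : ∀ {n m} → 3 + m ≡ n → (n≥3 : 3 ≤ n) (j : Fin (2 ^ n)) →
  w n (G n) (bracket n≥3 j) ≡ j
bracket-winner {m = m} refl n≥3 j = represented-winner m (bracket n≥3 j) (leafSelector n≥3 j)
  (bracket-represents n≥3 j) (represented-dominated n≥3 j) (represented-by-j n≥3 j)

theorem1 : ∀ (n : ℕ) (n≥3 : 3 ≤ n) (j : Fin (2 ^ n)) →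
    w n (G n) (bracket n≥3 j) ≡ j
theorem1 n n≥3 = bracket-winner (m+[n∸m]≡n n≥3) n≥3
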